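{- Let $(Y,w)$ be a positive weighted subset of a union of two shells $X_{r_1}\cup X_{r_2}$ (with $r_1\ne r_2$) in $H(n,2)$. Let $Y_{r_\nu}=Y\cap X_{r_\nu}$ and assume that $w(y)=w_{r_\nu}$ for any $y\in Y_{r_\nu}$, for $\nu=1,2$. Let $\mathcal B_{r_\nu}=\{B_y: y\in Y_{r_\nu}\}$ be the set of blocks corresponding to $Y_{r_\nu}$ and let $N_{r_\nu}=|Y_{r_\nu}|$ for $\nu=1,2$. Then $(Y,w)$ is a relative $t$-design of $H(n,2)$ (with respect to $u_0$) if and only if $(V,\mathcal B_{r_\nu})$ is a combinatorial $(t-1)$-$(n,r_\nu,\lambda^{(r_\nu)}_{t-1})$ design for $\nu=1,2$ and the equality $$\sum_{\nu=1}^2 w_{r_\nu}\lambda^{(r_\nu)}_t(i_1,\dots,i_t)=\sum_{\nu=1}^2 N_{r_\nu}w_{r_\nu}\prod_{j=0}^{t-1}\frac{r_\nu-j}{n-j}$$ holds for any distinct $t$ points $i_1,\dots,i_t$ in $V$, where $\lambda^{(r_\nu)}_t(i_1,\dots,i_t)$ denotes the number of blocks in $\mathcal B_{r_\nu}$ containing $\{i_1,\dots,i_t\}$.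
   Context: Let $V=\{1,\dots,n\}$, let $X=\{0,1\}^n$ be the point set of the binary Hamming scheme $H(n,2)$, $u_0=(0,\dots,0)$, and let the shell $X_r$ be the set of vectors in $X$ with exactly $r$ ones. For $x\in X$ put $B_x=\{i\in V: x_i=1\}$. A positive weighted subset $(Y,w)$ is a subset $Y\subset X$ with $w:Y\to\mathbb R_{>0}$. If $Y\subset X_{r_1}\cup\dots\cup X_{r_p}$ with distinct $r_\nu$, put $Y_{r_\nu}=Y\cap X_{r_\nu}$ and $w(Y_{r_\nu})=\sum_{y\in Y_{r_\nu}}w(y)$; then $(Y,w)$ is a relative $t$-design with respect to $u_0$ if for every $1\le j\le t$ and every $z\in X_j$ $$\sum_{\nu=1}^p\frac{w(Y_{r_\nu})}{|X_{r_\nu}|}\sum_{x\in X_{r_\nu}}f_z(x)=\sum_{y\in Y}w(y)f_z(y),$$ where $f_z(x)=1$ if $B_z\subset B_x$ and $f_z(x)=0$ otherwise. (This is the definition via the P-structure; for $H(n,2)$ it coincides with the one via the Q-structure.) A combinatorial $s$-$(n,k,\lambda)$ design is a pair $(V,\mathcal B)$ with $|V|=n$ and $\mathcal B$ a set of $k$-element subsets of $V$ such that every $s$-element subset of $V$ is contained in exactly $\lambda$ blocks.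
   Formalization: Adds t−1 ≤ r_ν for ν=1,2, without which the "if" direction fails (n=5, t=3, r_1=1, r_2=2, Y_{r_1}={e_1}, Y_{r_2}=X_2: a vacuous 2-(5,1,0) design, but the j=1 condition fails); also states r_ν ≤ n and t ≥ 1 explicitly. -}

module Defs where

open import Algebra.Apartness.Bundles using (HeytingField; HeytingCommutativeRing)
open import Algebra.Bundles using (CommutativeRing)
open import Data.Bool.Base using (Bool; true; false; if_then_else_)
open import Data.Fin.Base using (Fin)
open import Data.Fin.Subset using (Subset; ∣_∣; ⁅_⁆; ⋃)
open import Data.Fin.Subset.Properties using (_⊆?_)
open import Data.List.Base using (List; []; _∷_; _++_; map; filter; length; foldr; tabulate)
open import Data.List.Membership.Propositional using (_∈_)
open import Data.List.Relation.Unary.All using (All)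
open import Data.List.Relation.Unary.Unique.Propositional using (Unique)
open import Data.Nat.Base using (ℕ; zero; suc; _≤_; _∸_)
open import Data.Nat.Properties using (_≟_)
open import Data.Product.Base using (proj₁)
open import Data.Sum.Base using (_⊎_)
open import Data.Vec.Base using (Vec) renaming (_∷_ to _∷ᵥ_; [] to []ᵥ)
open import Function.Base using (_∘_)
open import Level as Level using (_⊔_)
open import Relation.Binary.Core using (Rel)
open import Relation.Binary.PropositionalEquality.Core using (_≡_)
open import Relation.Binary.Structures using (IsStrictPartialOrder)
open import Relation.Nullary.Decidable.Core using (⌊_⌋)

-- Weights take values in an arbitrary ordered field, which stands in for ℝ.
-- Invertibility is governed by apartness and the order is not assumed
-- decidable, so that the classical reals (with x # y meaning ¬ x ≈ y) and the
-- constructive reals are both instances.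

record OrderedField c ℓ₁ ℓ₂ ℓ₃ : Set (Level.suc (c ⊔ ℓ₁ ⊔ ℓ₂ ⊔ ℓ₃)) where
  infix 4 _<_
  field
    heytingField : HeytingField c ℓ₁ ℓ₂

  open HeytingField heytingField public
    hiding (_-_)

  field
    _<_ : Rel Carrier ℓ₃
    <-isStrictPartialOrder : IsStrictPartialOrder _≈_ _<_
    #⇒<⊎> : ∀ {x y} → x # y → x < y ⊎ y < x
    <⇒# : ∀ {x y} → x < y → x # y
    0<1 : 0# < 1#
    +-monoʳ-< : ∀ x {y z} → y < z → x + y < x + z
    *-pos : ∀ {x y} → 0# < x → 0# < y → 0# < x * y

  commutativeRing : CommutativeRing c ℓ₁
  commutativeRing = HeytingCommutativeRing.commutativeRing heytingCommutativeRing

  open CommutativeRing commutativeRing public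
    using (semiring; +-monoid; *-monoid)
  open import Algebra.Properties.Monoid.Mult +-monoid
    using () renaming (_×_ to _ℕ×_)
  open import Algebra.Properties.Monoid.Sum +-monoid public
    using () renaming (sum to ∑)
  open import Algebra.Properties.Monoid.Sum *-monoid public
    using () renaming (sum to ∏)

  open IsStrictPartialOrder <-isStrictPartialOrder public
    using (<-respʳ-≈; <-respˡ-≈)
    renaming (trans to <-trans; irrefl to <-irrefl)

  ι : ℕ → Carrier
  ι k = k ℕ× 1#

  0<ι : ∀ k → 0# < ι (suc k)
  0<ι zero    = <-respʳ-≈ (sym (+-identityʳ 1#)) 0<1
  0<ι (suc k) = <-trans 0<1 (<-respˡ-≈ (+-identityʳ 1#) (+-monoʳ-< 1# (0<ι k)))

  -- The inverse of ι (suc k), obtained from ι (suc k) # 0#.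
  ι⁻¹[1+_] : ℕ → Carrier
  ι⁻¹[1+ k ] = proj₁ (#⇒invertible (#-sym (<⇒# (0<ι k))))

  -- Division of a field element by a natural number.  The value at zero is a
  -- convention only: below, every divisor is |X_r| with r ≤ n, or n - j with
  -- j < n.
  infixl 7 _/_
  _/_ : Carrier → ℕ → Carrier
  x / zero  = 0#
  x / suc k = x * ι⁻¹[1+ k ]

  ∑ₗ : ∀ {a} {A : Set a} → List A → (A → Carrier) → Carrier
  ∑ₗ xs g = foldr (λ x s → g x + s) 0# xs

-- Finite sets (of points or of blocks) are lists without repetition.

Point : ℕ → Set
Point n = Vec Bool n

points : ∀ n → List (Point n)
points zero    = []ᵥ ∷ []
points (suc n) = map (false ∷ᵥ_) (points n) ++ map (true ∷ᵥ_) (points n)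

-- A subset of Fin n is by definition its characteristic vector in Vec Bool n,
-- so B is the identity; ∣ B x ∣ is then the number of ones of x.
B : ∀ {n} → Point n → Subset n
B x = x

infixl 6 _∩X_
_∩X_ : ∀ {n} → List (Point n) → ℕ → List (Point n)
Y ∩X r = filter (λ x → ∣ B x ∣ ≟ r) Y

X : ∀ n → ℕ → List (Point n)
X n r = points n ∩X r

blocks : ∀ {n} → List (Point n) → List (Subset n)
blocks = map B

#containing : ∀ {n} → List (Subset n) → Subset n → ℕ
#containing ℬ S = length (filter (S ⊆?_) ℬ)

pointSet : ∀ {n t} → (Fin t → Fin n) → Subset n
pointSet i = ⋃ (tabulate (⁅_⁆ ∘ i))

record IsDesign (s n k lam : ℕ) (ℬ : List (Subset n)) : Set where
  field
    unique    : Unique ℬ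
    blockSize : All (λ b → ∣ b ∣ ≡ k) ℬ
    balanced  : ∀ S → ∣ S ∣ ≡ s → #containing ℬ S ≡ lam

module _ {c ℓ₁ ℓ₂ ℓ₃} (F : OrderedField c ℓ₁ ℓ₂ ℓ₃) where
  open OrderedField F

  -- Only the values of w on Y matter.
  record PositiveWeightedSubset (n : ℕ) : Set (c ⊔ ℓ₃) where
    field
      Y      : List (Point n)
      unique : Unique Y
      w      : Point n → Carrier
      w-pos  : ∀ {y} → y ∈ Y → 0# < w y

  f : ∀ {n} → Point n → Point n → Carrier
  f z x = if ⌊ B z ⊆? B x ⌋ then 1# else 0#

  -- To be used when Y ⊆ X_{r 1} ∪ … ∪ X_{r p} with the r ν distinct.
  IsRelativeDesign : ∀ {n p} → ℕ → (Fin p → ℕ) → PositiveWeightedSubset n → Set ℓ₁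
  IsRelativeDesign {n} t r Yw =
    ∀ j → 1 ≤ j → j ≤ t → (z : Point n) → z ∈ X n j →
    ∑ (λ ν → ∑ₗ (Y ∩X r ν) w / length (X n (r ν)) * ∑ₗ (X n (r ν)) (f z))
      ≈ ∑ₗ Y (λ y → w y * f z y)
    where open PositiveWeightedSubset Yw

{-# OPTIONS --safe #-}
module Submission where

-- Let K(Z) and M(Z) be the numbers of blocks of Y ∩ X_r, resp. of X_r, above Z.
-- Double counting gives Σ_p K({p} ∪ Z) = r K(Z), and likewise for M.  The
-- relative t-design condition says Σ_ν a_ν K_ν(Z) = Σ_ν b_ν M_ν(Z) for all
-- |Z| ≤ t, with a_ν = w_{r_ν} and b_ν = w(Y_{r_ν}) / |X_{r_ν}|; for |Z| < t, summing it over all {p} ∪ Z gives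
-- Σ_ν r_ν a_ν K_ν(Z) = Σ_ν r_ν b_ν M_ν(Z), so since r₁ ≠ r₂ the equality holds for
-- each ν separately, and K_ν(Z) depends only on |Z|.  Conversely, for a
-- (t-1)-design the same double count descends from |Z| = t-1 to smaller Z and
-- shows that K_ν is proportional to M_ν there.

open import Defs
open import Algebra.Bundles using (CommutativeRing)
import Algebra.Properties.Semiring.Sum
open import Data.Bool.Base using (true; false; if_then_else_)
open import Data.Empty using () renaming (⊥ to Empty)
open import Data.Fin.Base using (Fin; zero; suc; toℕ)
open import Data.Fin.Patterns using (0F; 1F)
open import Data.Fin.Properties using (suc-injective; toℕ-inject₁; toℕ-fromℕ)
open import Data.Fin.Subset using (Subset; inside; outside; ⁅_⁆; _∪_; _⊆_; ∣_∣; ⊥)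
  renaming (_∈_ to _∈ₛ_; _∉_ to _∉ₛ_)
open import Data.Fin.Subset.Properties
  using (∣⊥∣≡0; ∣⁅x⁆∣≡1; p⊆q⇒∣p∣≤∣q∣; _⊆?_; _∈?_; ∪-identityˡ; q⊆p∪q; x∈p∪q⁻; x∈p∪q⁺;
         x∈⁅x⁆; x∈⁅y⁆⇒x≡y; drop-not-there; ∣p∣≤n; ∉⊥)
open import Data.List.Base using (List; []; _∷_; _++_; map; filter; length)
open import Data.List.Properties
  using (filter-++; filter-accept; filter-reject; filter-all; length-++; length-map; map-id; ++-identityʳ)
open import Data.List.Membership.Propositional using (_∈_)
open import Data.List.Membership.Propositional.Properties
  using (∈-++⁺ˡ; ∈-++⁺ʳ; ∈-map⁺; ∈-filter⁺; ∈-filter⁻)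
open import Data.List.Relation.Unary.All as All using (All; []; _∷_)
open import Data.List.Relation.Unary.All.Properties using (all-filter)
open import Data.List.Relation.Unary.Any using (here; there)
open import Data.List.Relation.Unary.Unique.Propositional using (Unique)
import Data.List.Relation.Unary.Unique.Propositional.Properties as Unique
open import Data.Nat.Base as ℕ using (ℕ; zero; suc; _≤_; _∸_)
import Data.Nat.Properties as ℕ
open import Data.Nat.Solver using (module +-*-Solver)
open import Data.Product.Base using (∃; _×_; _,_; proj₁; proj₂)
open import Data.Sum.Base using (_⊎_; inj₁; inj₂; [_,_])
open import Data.Vec.Base using ([]; _∷_; here; there)
open import Function.Base using (_∘_)
open import Function.Bundles using (_⇔_; mk⇔)
open import Function.Definitions using (Injective)
open import Relation.Binary.Definitions using (tri<; tri≈; tri>)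
open import Relation.Binary.PropositionalEquality as ≡ using (_≡_; _≢_)
open import Relation.Nullary.Decidable using (yes; no; does; dec-true; dec-false)
open import Relation.Nullary.Negation using (contradiction)
open import Relation.Unary using (Pred; Decidable)

private module ℕSum = Algebra.Properties.Semiring.Sum ℕ.+-*-semiring

module Counting where

  open import Data.Nat.Base using (_+_; _*_; _<_; z≤n; s≤s; >-nonZero)
  open import Data.Nat.Properties hiding (suc-injective)
  open import Relation.Binary.PropositionalEquality hiding ([_])
  open ℕSum using (sum; sum-cong-≗; ∑-distrib-+; *-distribˡ-sum)
  open +-*-Solver using (solve; _:+_; _:*_; _:=_; con)

  private
    variable
      n k : ℕ

  -- Adjoining a point to a subset.

  absorb : ∀ {p} {Z : Subset n} → p ∈ₛ Z → ⁅ p ⁆ ∪ Z ≡ Z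
  absorb {Z = inside ∷ Z} here      = cong (inside ∷_) (∪-identityˡ Z)
  absorb {Z = _ ∷ Z}      (there q) = cong (_ ∷_) (absorb q)

  ∣⁅p⁆∪Z∣ : ∀ {p} {Z : Subset n} → p ∉ₛ Z → ∣ ⁅ p ⁆ ∪ Z ∣ ≡ suc ∣ Z ∣
  ∣⁅p⁆∪Z∣ {p = zero}  {inside  ∷ Z} p∉Z = contradiction here p∉Z
  ∣⁅p⁆∪Z∣ {p = zero}  {outside ∷ Z} p∉Z = cong (suc ∘ ∣_∣) (∪-identityˡ Z)
  ∣⁅p⁆∪Z∣ {p = suc p} {inside  ∷ Z} p∉Z = cong suc (∣⁅p⁆∪Z∣ (drop-not-there p∉Z))
  ∣⁅p⁆∪Z∣ {p = suc p} {outside ∷ Z} p∉Z = ∣⁅p⁆∪Z∣ (drop-not-there p∉Z)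

  ∣⁅p⁆∪Z∣≤ : ∀ p (Z : Subset n) → ∣ ⁅ p ⁆ ∪ Z ∣ ≤ suc ∣ Z ∣
  ∣⁅p⁆∪Z∣≤ p Z with p ∈? Z
  ... | yes p∈Z = ≤-trans (≤-reflexive (cong ∣_∣ (absorb p∈Z))) (n≤1+n _)
  ... | no  p∉Z = ≤-reflexive (∣⁅p⁆∪Z∣ p∉Z)

  -- Only the Boolean answers of the two tests are compared. Size and inclusion tests on a prefixed
  -- vector reduce to tests on its tail, so the hypothesis is met by `refl`.
  filter-map : ∀ {a b p q} {A : Set a} {B : Set b} {P : Pred B p} {Q : Pred A q}
               (P? : Decidable P) (Q? : Decidable Q) (f : A → B) →
               (∀ x → does (P? (f x)) ≡ does (Q? x)) →
               ∀ xs → filter P? (map f xs) ≡ map f (filter Q? xs)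
  filter-map P? Q? f eq []       = refl
  filter-map P? Q? f eq (x ∷ xs) rewrite eq x with does (Q? x)
  ... | true  = cong (f x ∷_) (filter-map P? Q? f eq xs)
  ... | false = filter-map P? Q? f eq xs

  -- Sums of natural numbers over the points of `Fin n`.

  sum-const : ∀ n c → sum {n} (λ _ → c) ≡ n * c
  sum-const zero    c = refl
  sum-const (suc n) c = cong (c +_) (sum-const n c)

  -- Both sides are moved so that no subtraction occurs.
  sum-exchange : (Z : Subset n) (g h : Fin n → ℕ) {x y : ℕ} →
                 (∀ {p} → p ∈ₛ Z → g p ≡ x) → (∀ {p} → p ∈ₛ Z → h p ≡ y) →
                 (∀ {p} → p ∉ₛ Z → g p ≡ h p) →
                 sum g + ∣ Z ∣ * y ≡ sum h + ∣ Z ∣ * x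
  sum-exchange [] g h gx hy gh = refl
  sum-exchange (outside ∷ Z) g h {x} {y} gx hy gh = begin
    g zero + sum (g ∘ suc) + ∣ Z ∣ * y    ≡⟨ +-assoc (g zero) _ _ ⟩
    g zero + (sum (g ∘ suc) + ∣ Z ∣ * y)  ≡⟨ cong₂ _+_ (gh λ ()) (sum-exchange Z (g ∘ suc) (h ∘ suc)
                                               (gx ∘ there) (hy ∘ there) λ p∉Z → gh λ { (there q) → p∉Z q }) ⟩
    h zero + (sum (h ∘ suc) + ∣ Z ∣ * x)  ≡⟨ +-assoc (h zero) _ _ ⟨
    h zero + sum (h ∘ suc) + ∣ Z ∣ * x    ∎
    where open ≡-Reasoning
  sum-exchange (inside ∷ Z) g h {x} {y} gx hy gh = begin
    g zero + sum (g ∘ suc) + (y + ∣ Z ∣ * y)  ≡⟨ cong (λ u → u + sum (g ∘ suc) + (y + ∣ Z ∣ * y)) (gx here) ⟩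
    x + sum (g ∘ suc) + (y + ∣ Z ∣ * y)       ≡⟨ shuffle x _ y _ ⟩
    (sum (g ∘ suc) + ∣ Z ∣ * y) + (x + y)     ≡⟨ cong (_+ (x + y)) (sum-exchange Z (g ∘ suc) (h ∘ suc)
                                                   (gx ∘ there) (hy ∘ there) λ p∉Z → gh λ { (there q) → p∉Z q }) ⟩
    (sum (h ∘ suc) + ∣ Z ∣ * x) + (x + y)     ≡⟨ cong ((sum (h ∘ suc) + ∣ Z ∣ * x) +_) (+-comm x y) ⟩
    (sum (h ∘ suc) + ∣ Z ∣ * x) + (y + x)     ≡⟨ shuffle y _ x _ ⟨
    y + sum (h ∘ suc) + (x + ∣ Z ∣ * x)       ≡⟨ cong (λ u → u + sum (h ∘ suc) + (x + ∣ Z ∣ * x)) (hy here) ⟨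
    h zero + sum (h ∘ suc) + (x + ∣ Z ∣ * x)  ∎
    where
    open ≡-Reasoning
    shuffle : ∀ a s b m → a + s + (b + m) ≡ (s + m) + (a + b)
    shuffle = solve 4 (λ a s b m → a :+ s :+ (b :+ m) := (s :+ m) :+ (a :+ b)) refl

  -- Double counting and homogeneous functions on subsets.

  χ : Subset n → Subset n → ℕ
  χ Z b = if does (Z ⊆? b) then 1 else 0

  χ-⊆ : {Z b : Subset n} → Z ⊆ b → χ Z b ≡ 1
  χ-⊆ {Z = Z} {b} Z⊆b rewrite dec-true (Z ⊆? b) Z⊆b = refl

  χ-⊈ : {Z b : Subset n} → (Z ⊆ b → Empty) → χ Z b ≡ 0
  χ-⊈ {Z = Z} {b} Z⊈b rewrite dec-false (Z ⊆? b) Z⊈b = refl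

  #containing-∷ : ∀ b (ℬ : List (Subset n)) Z → #containing (b ∷ ℬ) Z ≡ χ Z b + #containing ℬ Z
  #containing-∷ b ℬ Z with does (Z ⊆? b)
  ... | true  = refl
  ... | false = refl

  sum-∈? : (b : Subset n) → sum (λ p → if does (p ∈? b) then 1 else 0) ≡ ∣ b ∣
  sum-∈? []            = refl
  sum-∈? (inside  ∷ b) = cong suc (sum-∈? b)
  sum-∈? (outside ∷ b) = sum-∈? b

  -- If `b` does not contain `Z`, it contains no enlargement of `Z` and all terms vanish. If it
  -- does, the term at `p` tests `p ∈ b`; points of `Z` pass this test too, so the factor is `∣ b ∣`
  -- with nothing subtracted.
  sum-χ : (b Z : Subset n) → sum (λ p → χ (⁅ p ⁆ ∪ Z) b) ≡ ∣ b ∣ * χ Z b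
  sum-χ {n} b Z with Z ⊆? b
  ... | no Z⊈b = begin
    sum (λ p → χ (⁅ p ⁆ ∪ Z) b)  ≡⟨ sum-cong-≗ (λ p → χ-⊈ {b = b} λ pZ⊆b → Z⊈b (pZ⊆b ∘ q⊆p∪q ⁅ p ⁆ Z)) ⟩
    sum {n} (λ _ → 0)            ≡⟨ sum-const n 0 ⟩
    n * 0                        ≡⟨ *-zeroʳ n ⟩
    0                            ≡⟨ *-zeroʳ ∣ b ∣ ⟨
    ∣ b ∣ * 0                    ∎
    where open ≡-Reasoning
  ... | yes Z⊆b = begin
    sum (λ p → χ (⁅ p ⁆ ∪ Z) b)                    ≡⟨ sum-cong-≗ χ-∈ ⟩
    sum (λ p → if does (p ∈? b) then 1 else 0)     ≡⟨ sum-∈? b ⟩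
    ∣ b ∣                                          ≡⟨ *-identityʳ ∣ b ∣ ⟨
    ∣ b ∣ * 1                                      ∎
    where
    open ≡-Reasoning
    χ-∈ : ∀ p → χ (⁅ p ⁆ ∪ Z) b ≡ (if does (p ∈? b) then 1 else 0)
    χ-∈ p with p ∈? b
    ... | yes p∈b = χ-⊆ {Z = ⁅ p ⁆ ∪ Z} λ q∈ → [ (λ q∈⁅p⁆ → subst (_∈ₛ b) (sym (x∈⁅y⁆⇒x≡y p q∈⁅p⁆)) p∈b) , Z⊆b ] (x∈p∪q⁻ ⁅ p ⁆ Z q∈)
    ... | no  p∉b = χ-⊈ {Z = ⁅ p ⁆ ∪ Z} λ pZ⊆b → p∉b (pZ⊆b (x∈p∪q⁺ (inj₁ (x∈⁅x⁆ p))))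

  -- The sum also runs over the points of `Z`, where the summand is `G Z` itself. Over the points
  -- outside `Z` alone the factor would be `k - ∣ Z ∣`; the present form avoids this subtraction.
  Homogeneous : ℕ → (Subset n → ℕ) → Set
  Homogeneous {n} k G = ∀ Z → sum (λ p → G (⁅ p ⁆ ∪ Z)) ≡ k * G Z

  #containing-homogeneous : {ℬ : List (Subset n)} → All (λ b → ∣ b ∣ ≡ k) ℬ →
                            Homogeneous k (#containing ℬ)
  #containing-homogeneous {n} {k} [] Z = begin
    sum {n} (λ _ → 0)  ≡⟨ sum-const n 0 ⟩
    n * 0              ≡⟨ *-zeroʳ n ⟩
    0                  ≡⟨ *-zeroʳ k ⟨
    k * 0              ∎
    where open ≡-Reasoning
  #containing-homogeneous {n} {k} {b ∷ ℬ} (∣b∣≡k ∷ ∣ℬ∣≡k) Z = begin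
    sum (λ p → #containing (b ∷ ℬ) (⁅ p ⁆ ∪ Z))
      ≡⟨ sum-cong-≗ (λ p → #containing-∷ b ℬ (⁅ p ⁆ ∪ Z)) ⟩
    sum (λ p → χ (⁅ p ⁆ ∪ Z) b + #containing ℬ (⁅ p ⁆ ∪ Z))
      ≡⟨ ∑-distrib-+ {n} _ _ ⟩
    sum (λ p → χ (⁅ p ⁆ ∪ Z) b) + sum (λ p → #containing ℬ (⁅ p ⁆ ∪ Z))
      ≡⟨ cong₂ _+_ (trans (sum-χ b Z) (cong (_* χ Z b) ∣b∣≡k)) (#containing-homogeneous ∣ℬ∣≡k Z) ⟩
    k * χ Z b + k * #containing ℬ Z
      ≡⟨ *-distribˡ-+ k _ _ ⟨
    k * (χ Z b + #containing ℬ Z)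
      ≡⟨ cong (k *_) (#containing-∷ b ℬ Z) ⟨
    k * #containing (b ∷ ℬ) Z ∎
    where open ≡-Reasoning

  *-homogeneous : {G : Subset n → ℕ} → ∀ α → Homogeneous k G → Homogeneous k (λ Z → α * G Z)
  *-homogeneous {n} {k} {G} α hom Z = begin
    sum (λ p → α * G (⁅ p ⁆ ∪ Z))  ≡⟨ *-distribˡ-sum {n} α _ ⟨
    α * sum (λ p → G (⁅ p ⁆ ∪ Z))  ≡⟨ cong (α *_) (hom Z) ⟩
    α * (k * G Z)                  ≡⟨ solve 3 (λ a b c → a :* (b :* c) := b :* (a :* c)) refl α k (G Z) ⟩
    k * (α * G Z)                  ∎
    where open ≡-Reasoning

  -- The summands at points outside `Z` agree by hypothesis, and the others are `G Z` and `H Z`.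
  -- Hence `(k - j) G Z = (k - j) H Z`, with `k - j` positive.
  homogeneous-descent : {G H : Subset n → ℕ} → Homogeneous k G → Homogeneous k H →
                        ∀ {j} → j < k →
                        (∀ Z → ∣ Z ∣ ≡ suc j → G Z ≡ H Z) →
                        ∀ Z → ∣ Z ∣ ≡ j → G Z ≡ H Z
  homogeneous-descent {n} {k} {G} {H} homG homH {j} j<k eq Z refl
    -- Here `k = suc (∣ Z ∣ + d)`, so `suc d` is the factor `k - j` to be cancelled. Adding
    -- `∣ Z ∣ * (G Z + H Z)` brings both sides to the form that `sum-exchange` compares.
    with d , refl ← m≤n⇒∃[o]m+o≡n j<k =
    *-cancelˡ-≡ (G Z) (H Z) (suc d) (+-cancelʳ-≡ (∣ Z ∣ * (G Z + H Z)) _ _ (begin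
      suc d * G Z + ∣ Z ∣ * (G Z + H Z)             ≡⟨ shuffle ∣ Z ∣ d (G Z) (H Z) ⟩
      suc (∣ Z ∣ + d) * G Z + ∣ Z ∣ * H Z           ≡⟨ cong (_+ ∣ Z ∣ * H Z) (homG Z) ⟨
      sum (λ p → G (⁅ p ⁆ ∪ Z)) + ∣ Z ∣ * H Z       ≡⟨ sum-exchange Z _ _ (cong G ∘ absorb) (cong H ∘ absorb)
                                                         (λ p∉Z → eq _ (∣⁅p⁆∪Z∣ p∉Z)) ⟩
      sum (λ p → H (⁅ p ⁆ ∪ Z)) + ∣ Z ∣ * G Z       ≡⟨ cong (_+ ∣ Z ∣ * G Z) (homH Z) ⟩
      suc (∣ Z ∣ + d) * H Z + ∣ Z ∣ * G Z           ≡⟨ shuffle ∣ Z ∣ d (H Z) (G Z) ⟨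
      suc d * H Z + ∣ Z ∣ * (H Z + G Z)             ≡⟨ cong (λ u → suc d * H Z + ∣ Z ∣ * u) (+-comm (H Z) (G Z)) ⟩
      suc d * H Z + ∣ Z ∣ * (G Z + H Z)             ∎))
    where
    open ≡-Reasoning
    shuffle : ∀ z d x y → suc d * x + z * (x + y) ≡ suc (z + d) * x + z * y
    shuffle = solve 4 (λ z d x y → (con 1 :+ d) :* x :+ z :* (x :+ y)
                         := (con 1 :+ (z :+ d)) :* x :+ z :* y) refl

  homogeneous-descent* : {G H : Subset n → ℕ} → Homogeneous k G → Homogeneous k H →
                         ∀ {s} → s ≤ k →
                         (∀ Z → ∣ Z ∣ ≡ s → G Z ≡ H Z) →
                         ∀ Z → ∣ Z ∣ ≤ s → G Z ≡ H Z
  homogeneous-descent* homG homH {zero} s≤k eq Z ∣Z∣≤s = eq Z (n≤0⇒n≡0 ∣Z∣≤s)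
  homogeneous-descent* homG homH {suc s} s<k eq Z ∣Z∣≤s with m≤n⇒m<n∨m≡n ∣Z∣≤s
  ... | inj₂ ∣Z∣≡s       = eq Z ∣Z∣≡s
  ... | inj₁ (s≤s ∣Z∣≤s) =
    homogeneous-descent* homG homH (<⇒≤ s<k) (homogeneous-descent homG homH s<k eq) Z ∣Z∣≤s

  -- Counting in the full shells.

  X-zero : ∀ n → X (suc n) 0 ≡ map (false ∷_) (X n 0)
  X-zero n = begin
    X (suc n) 0
      ≡⟨ filter-++ (λ x → ∣ x ∣ ≟ 0) (map (false ∷_) (points n)) _ ⟩
    map (false ∷_) (points n) ∩X 0 ++ map (true ∷_) (points n) ∩X 0
      ≡⟨ cong₂ _++_ (filter-map _ _ (false ∷_) (λ _ → refl) (points n)) (none (points n)) ⟩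
    map (false ∷_) (X n 0) ++ []
      ≡⟨ ++-identityʳ _ ⟩
    map (false ∷_) (X n 0) ∎
    where
    open ≡-Reasoning
    none : ∀ xs → map (true ∷_) xs ∩X 0 ≡ []
    none []       = refl
    none (x ∷ xs) = none xs

  X-suc : ∀ n r → X (suc n) (suc r) ≡ map (false ∷_) (X n (suc r)) ++ map (true ∷_) (X n r)
  X-suc n r = begin
    X (suc n) (suc r)
      ≡⟨ filter-++ (λ x → ∣ x ∣ ≟ suc r) (map (false ∷_) (points n)) _ ⟩
    map (false ∷_) (points n) ∩X suc r ++ map (true ∷_) (points n) ∩X suc r
      ≡⟨ cong₂ _++_ (filter-map _ _ (false ∷_) (λ _ → refl) (points n))
                    (filter-map _ _ (true ∷_) (λ _ → refl) (points n)) ⟩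
    map (false ∷_) (X n (suc r)) ++ map (true ∷_) (X n r) ∎
    where open ≡-Reasoning

  #containing-++ : (ℬ ℬ′ : List (Subset n)) (Z : Subset n) →
                   #containing (ℬ ++ ℬ′) Z ≡ #containing ℬ Z + #containing ℬ′ Z
  #containing-++ ℬ ℬ′ Z = trans (cong length (filter-++ (Z ⊆?_) ℬ ℬ′)) (length-++ (filter (Z ⊆?_) ℬ))

  #containing-map-∷ : ∀ (ℬ : List (Subset n)) Z {s s′} → (∀ b → does (s ∷ Z ⊆? s′ ∷ b) ≡ does (Z ⊆? b)) →
                      #containing (map (s′ ∷_) ℬ) (s ∷ Z) ≡ #containing ℬ Z
  #containing-map-∷ ℬ Z eq = trans (cong length (filter-map _ _ (_ ∷_) eq ℬ)) (length-map _ (filter (Z ⊆?_) ℬ))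

  #containing-map-out-in : ∀ (ℬ : List (Subset n)) Z → #containing (map (outside ∷_) ℬ) (inside ∷ Z) ≡ 0
  #containing-map-out-in []      Z = refl
  #containing-map-out-in (b ∷ ℬ) Z = #containing-map-out-in ℬ Z

  -- For j ≤ n, the number of points of X n r above any fixed point of X n j.
  aboveCount : ℕ → ℕ → ℕ → ℕ
  aboveCount n       r       zero    = length (X n r)
  aboveCount zero    r       (suc j) = 0
  aboveCount (suc n) zero    (suc j) = 0
  aboveCount (suc n) (suc r) (suc j) = aboveCount n r j

  aboveCount-zero : ∀ n j → j ≤ n → aboveCount (suc n) zero j ≡ aboveCount n zero j
  aboveCount-zero n       zero    _ = trans (cong length (X-zero n)) (length-map _ (X n 0))
  aboveCount-zero (suc n) (suc j) _ = refl

  -- Pascal's rule for the binomial coefficient C(n - j, r - j). The induction strips one coordinate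
  -- at a time; at `j = 0` the shell splits by its first coordinate. The bound `j ≤ n` matters: at
  -- `n = 0`, `r = 0`, `j = 1` the left side is 1 and the right side is 0.
  aboveCount-pascal : ∀ n r j → j ≤ n →
                      aboveCount (suc n) (suc r) j ≡ aboveCount n (suc r) j + aboveCount n r j
  aboveCount-pascal n r zero _ =
    trans (cong length (X-suc n r))
    (trans (length-++ (map (false ∷_) (X n (suc r))))
           (cong₂ _+_ (length-map _ (X n (suc r))) (length-map _ (X n r))))
  aboveCount-pascal (suc n) zero    (suc j) (s≤s j≤n) = trans (aboveCount-zero n j j≤n) (sym (+-identityʳ _))
  aboveCount-pascal (suc n) (suc r) (suc j) (s≤s j≤n) = aboveCount-pascal n r j j≤n

  -- Split the shell by the first coordinate. If that coordinate lies in `Z`, at most the half with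
  -- `true` survives, and `n`, `r`, `∣ Z ∣` all drop by one; otherwise both halves count and
  -- Pascal's rule adds them. So the count depends on `Z` only through its size.
  #containing-X : ∀ r (Z : Subset n) → #containing (X n r) Z ≡ aboveCount n r ∣ Z ∣
  #containing-X zero    [] = refl
  #containing-X (suc r) [] = refl
  #containing-X {suc n} zero (inside ∷ Z) =
    trans (cong (λ ℬ → #containing ℬ (inside ∷ Z)) (X-zero n)) (#containing-map-out-in (X n 0) Z)
  #containing-X {suc n} zero (outside ∷ Z) = begin
    #containing (X (suc n) 0) (outside ∷ Z)
      ≡⟨ cong (λ ℬ → #containing ℬ (outside ∷ Z)) (X-zero n) ⟩
    #containing (map (false ∷_) (X n 0)) (outside ∷ Z)
      ≡⟨ #containing-map-∷ (X n 0) Z (λ _ → refl) ⟩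
    #containing (X n 0) Z
      ≡⟨ #containing-X 0 Z ⟩
    aboveCount n 0 ∣ Z ∣
      ≡⟨ aboveCount-zero n ∣ Z ∣ (∣p∣≤n Z) ⟨
    aboveCount (suc n) 0 ∣ Z ∣ ∎
    where open ≡-Reasoning
  #containing-X {suc n} (suc r) (inside ∷ Z) = begin
    #containing (X (suc n) (suc r)) (inside ∷ Z)
      ≡⟨ cong (λ ℬ → #containing ℬ (inside ∷ Z)) (X-suc n r) ⟩
    #containing (map (false ∷_) (X n (suc r)) ++ map (true ∷_) (X n r)) (inside ∷ Z)
      ≡⟨ #containing-++ (map (false ∷_) (X n (suc r))) _ (inside ∷ Z) ⟩
    #containing (map (false ∷_) (X n (suc r))) (inside ∷ Z) + #containing (map (true ∷_) (X n r)) (inside ∷ Z)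
      ≡⟨ cong₂ _+_ (#containing-map-out-in (X n (suc r)) Z) (#containing-map-∷ (X n r) Z (λ _ → refl)) ⟩
    #containing (X n r) Z
      ≡⟨ #containing-X r Z ⟩
    aboveCount n r ∣ Z ∣ ∎
    where open ≡-Reasoning
  #containing-X {suc n} (suc r) (outside ∷ Z) = begin
    #containing (X (suc n) (suc r)) (outside ∷ Z)
      ≡⟨ cong (λ ℬ → #containing ℬ (outside ∷ Z)) (X-suc n r) ⟩
    #containing (map (false ∷_) (X n (suc r)) ++ map (true ∷_) (X n r)) (outside ∷ Z)
      ≡⟨ #containing-++ (map (false ∷_) (X n (suc r))) _ (outside ∷ Z) ⟩
    #containing (map (false ∷_) (X n (suc r))) (outside ∷ Z) + #containing (map (true ∷_) (X n r)) (outside ∷ Z)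
      ≡⟨ cong₂ _+_ (#containing-map-∷ (X n (suc r)) Z (λ _ → refl)) (#containing-map-∷ (X n r) Z (λ _ → refl)) ⟩
    #containing (X n (suc r)) Z + #containing (X n r) Z
      ≡⟨ cong₂ _+_ (#containing-X (suc r) Z) (#containing-X r Z) ⟩
    aboveCount n (suc r) ∣ Z ∣ + aboveCount n r ∣ Z ∣
      ≡⟨ aboveCount-pascal n r ∣ Z ∣ (∣p∣≤n Z) ⟨
    aboveCount (suc n) (suc r) ∣ Z ∣ ∎
    where open ≡-Reasoning

  aboveCount-pos : ∀ {n r j} → j ≤ r → r ≤ n → 0 < aboveCount n r j
  aboveCount-pos {zero}  {zero}  {zero}  _ _ = s≤s z≤n
  aboveCount-pos {suc n} {zero}  {zero}  _ _ =
    subst (0 <_) (sym (aboveCount-zero n 0 z≤n)) (aboveCount-pos {n} {zero} z≤n z≤n)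
  aboveCount-pos {suc n} {suc r} {zero}  _ (s≤s r≤n) =
    subst (0 <_) (sym (aboveCount-pascal n r 0 z≤n))
      (≤-trans (aboveCount-pos {n} {r} z≤n r≤n) (m≤n+m _ _))
  aboveCount-pos {suc n} {suc r} {suc j} (s≤s j≤r) (s≤s r≤n) = aboveCount-pos j≤r r≤n

  ∣X∣ : ∀ {n} r → All (λ x → ∣ x ∣ ≡ r) (X n r)
  ∣X∣ {n} r = all-filter (λ x → ∣ x ∣ ≟ r) (points n)

  -- Subsets as sets of distinct points.

  pointSet-suc : ∀ {t} (i : Fin t → Fin n) → pointSet (suc ∘ i) ≡ outside ∷ pointSet i
  pointSet-suc {t = zero}  i = refl
  pointSet-suc {t = suc t} i = cong ((outside ∷ ⁅ i zero ⁆) ∪_) (pointSet-suc (i ∘ suc))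

  -- Lets a condition on `t` distinct points be read as one on subsets of size `t`; `∣pointSet∣`
  -- serves the opposite reading.
  enumerate : (Z : Subset n) → ∃ λ (i : Fin ∣ Z ∣ → Fin n) → Injective _≡_ _≡_ i × pointSet i ≡ Z
  enumerate [] = (λ ()) , (λ { {()} }) , refl
  enumerate (outside ∷ Z) with i , inj , eq ← enumerate Z =
    suc ∘ i , inj ∘ suc-injective , trans (pointSet-suc i) (cong (outside ∷_) eq)
  enumerate {suc n} (inside ∷ Z) with i , inj , eq ← enumerate Z =
    i⁺ , inj⁺ , trans (cong (⁅ zero ⁆ ∪_) (pointSet-suc i)) (cong (inside ∷_) (trans (∪-identityˡ _) eq))
    where
    i⁺ : Fin (suc ∣ Z ∣) → Fin (suc n)
    i⁺ zero    = zero
    i⁺ (suc p) = suc (i p)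
    inj⁺ : Injective _≡_ _≡_ i⁺
    inj⁺ {zero}  {zero}  _   = refl
    inj⁺ {suc p} {suc q} eq′ = cong suc (inj (suc-injective eq′))

  ∈-pointSet⁻ : ∀ {t} (i : Fin t → Fin n) {p} → p ∈ₛ pointSet i → ∃ λ q → p ≡ i q
  ∈-pointSet⁻ {t = zero}  i p∈ = contradiction p∈ ∉⊥
  ∈-pointSet⁻ {t = suc t} i p∈ with x∈p∪q⁻ ⁅ i zero ⁆ _ p∈
  ... | inj₁ p∈⁅i0⁆ = zero , x∈⁅y⁆⇒x≡y _ p∈⁅i0⁆
  ... | inj₂ p∈rest with q , eq ← ∈-pointSet⁻ (i ∘ suc) p∈rest = suc q , eq

  ∣pointSet∣ : ∀ {t} (i : Fin t → Fin n) → Injective _≡_ _≡_ i → ∣ pointSet i ∣ ≡ t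
  ∣pointSet∣ {n} {zero}  i inj = ∣⊥∣≡0 n
  ∣pointSet∣ {n} {suc t} i inj =
    trans (∣⁅p⁆∪Z∣ λ i0∈ → case (∈-pointSet⁻ (i ∘ suc) i0∈))
          (cong suc (∣pointSet∣ (i ∘ suc) (suc-injective ∘ inj)))
    where
    case : (∃ λ q → i zero ≡ i (suc q)) → Empty
    case (q , eq) with () ← inj eq

  ∈-points : (x : Point n) → x ∈ points n
  ∈-points []          = here refl
  ∈-points (false ∷ x) = ∈-++⁺ˡ (∈-map⁺ (false ∷_) (∈-points x))
  ∈-points (true ∷ x)  = ∈-++⁺ʳ _ (∈-map⁺ (true ∷_) (∈-points x))

  subsetOfSize : ∀ {n j} → j ≤ n → ∃ λ (Z : Subset n) → ∣ Z ∣ ≡ j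
  subsetOfSize {n}     {zero}  _ = ⊥ , ∣⊥∣≡0 n
  subsetOfSize {suc n} {suc j} (s≤s j≤n) with Z , eq ← subsetOfSize j≤n = inside ∷ Z , cong suc eq

  -- Among the `n` enlargements `⁅ p ⁆ ∪ Z` of a set of size `j`, the `j` with `p ∈ Z` contribute
  -- the count at size `j` and the other `n - j` the count at size `j + 1`; by double counting the
  -- total is `r` times the count at size `j`.
  aboveCount-ratio : ∀ {n r j} → j ≤ n → j ≤ r →
                     (n ∸ j) * aboveCount n r (suc j) ≡ (r ∸ j) * aboveCount n r j
  aboveCount-ratio {n} {r} {j} j≤n j≤r
    -- The claim involves numbers only; any subset of size `j` serves to apply the double count.
    with Z , refl ← subsetOfSize j≤n =
    sym (+-cancelʳ-≡ (∣ Z ∣ * (κ + κ′)) _ _ (begin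
      b * κ + ∣ Z ∣ * (κ + κ′)                            ≡⟨ shuffle₁ ∣ Z ∣ b κ κ′ ⟩
      (∣ Z ∣ + b) * κ + ∣ Z ∣ * κ′                        ≡⟨ cong (λ u → u * κ + ∣ Z ∣ * κ′) (m+[n∸m]≡n j≤r) ⟩
      r * κ + ∣ Z ∣ * κ′                                  ≡⟨ cong (_+ ∣ Z ∣ * κ′) homκ ⟨
      -- The comparison function is the constant `κ′`, which agrees with the summand off `Z`.
      sum (λ p → κ∘∣ ⁅ p ⁆ ∪ Z ∣) + ∣ Z ∣ * κ′            ≡⟨ sum-exchange Z _ (λ _ → κ′) (cong κ∘∣_∣ ∘ absorb) (λ _ → refl)
                                                               (cong (aboveCount n r) ∘ ∣⁅p⁆∪Z∣) ⟩
      sum {n} (λ _ → κ′) + ∣ Z ∣ * κ                      ≡⟨ cong (_+ ∣ Z ∣ * κ) (sum-const n κ′) ⟩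
      n * κ′ + ∣ Z ∣ * κ                                  ≡⟨ cong (λ u → u * κ′ + ∣ Z ∣ * κ) (m+[n∸m]≡n j≤n) ⟨
      (∣ Z ∣ + a) * κ′ + ∣ Z ∣ * κ                        ≡⟨ shuffle₂ ∣ Z ∣ a κ κ′ ⟩
      a * κ′ + ∣ Z ∣ * (κ + κ′)                           ∎))
    where
    open ≡-Reasoning
    a b : ℕ
    a = n ∸ ∣ Z ∣
    b = r ∸ ∣ Z ∣
    κ∘∣_∣ : Subset n → ℕ
    κ∘∣ Z′ ∣ = aboveCount n r ∣ Z′ ∣
    κ κ′ : ℕ
    κ  = κ∘∣ Z ∣
    κ′ = aboveCount n r (suc ∣ Z ∣)
    homκ : sum (λ p → κ∘∣ ⁅ p ⁆ ∪ Z ∣) ≡ r * κ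
    homκ = trans (sum-cong-≗ λ p → sym (#containing-X r (⁅ p ⁆ ∪ Z)))
          (trans (#containing-homogeneous (∣X∣ r) Z) (cong (r *_) (#containing-X r Z)))
    shuffle₁ : ∀ z b x y → b * x + z * (x + y) ≡ (z + b) * x + z * y
    shuffle₁ = solve 4 (λ z b x y → b :* x :+ z :* (x :+ y) := (z :+ b) :* x :+ z :* y) refl
    shuffle₂ : ∀ z a x y → (z + a) * y + z * x ≡ a * y + z * (x + y)
    shuffle₂ = solve 4 (λ z a x y → (z :+ a) :* y :+ z :* x := a :* y :+ z :* (x :+ y)) refl

  -- Block counts in a design.

  #containing-∅ : (ℬ : List (Subset n)) (Z : Subset n) → ∣ Z ∣ ≡ 0 → #containing ℬ Z ≡ length ℬ
  #containing-∅ ℬ Z ∣Z∣≡0 = cong length (filter-all (Z ⊆?_) (All.universal (λ b {p} p∈Z →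
    contradiction (≤-trans (≤-reflexive (sym (∣⁅x⁆∣≡1 p)))
      (≤-trans (p⊆q⇒∣p∣≤∣q∣ λ q∈⁅p⁆ → subst (_∈ₛ Z) (sym (x∈⁅y⁆⇒x≡y p q∈⁅p⁆)) p∈Z) (≤-reflexive ∣Z∣≡0))) λ ()) ℬ))

  -- The multiples of #containing ℬ and #containing (X n k) that agree on
  -- s-subsets agree below by homogeneity; Z = ∅ then gives the constant.
  design-proportion : ∀ {s k lam} {ℬ : List (Subset n)} → IsDesign s n k lam ℬ → s ≤ k → k ≤ n →
                      ∀ Z → ∣ Z ∣ ≤ s →
                      #containing ℬ Z * length (X n k) ≡ length ℬ * #containing (X n k) Z
  design-proportion {n} {s} {k} {lam} {ℬ} D s≤k k≤n Z ∣Z∣≤s = *-cancelˡ-≡ _ _ α {{>-nonZero (aboveCount-pos s≤k k≤n)}} (begin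
    α * (#containing ℬ Z * length (X n k))      ≡⟨ *-assoc α _ _ ⟨
    α * #containing ℬ Z * length (X n k)        ≡⟨ cong (_* length (X n k)) (agree Z ∣Z∣≤s) ⟩
    lam * #containing (X n k) Z * length (X n k) ≡⟨ solve 3 (λ a b c → a :* b :* c := a :* c :* b) refl lam (#containing (X n k) Z) (length (X n k)) ⟩
    lam * length (X n k) * #containing (X n k) Z ≡⟨ cong (_* #containing (X n k) Z) agree-∅ ⟨
    α * length ℬ * #containing (X n k) Z        ≡⟨ *-assoc α _ _ ⟩
    α * (length ℬ * #containing (X n k) Z)      ∎)
    where
    open ≡-Reasoning
    open IsDesign D
    -- On `s`-sets the shell has the constant count `α` and `ℬ` the constant count `lam`, so these
    -- are the two cross multipliers. `α` is positive because `s ≤ k ≤ n`.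
    α : ℕ
    α = aboveCount n k s
    agree : ∀ Z → ∣ Z ∣ ≤ s → α * #containing ℬ Z ≡ lam * #containing (X n k) Z
    agree = homogeneous-descent* (*-homogeneous {k = k} {G = #containing ℬ} α (#containing-homogeneous blockSize))
      (*-homogeneous {k = k} {G = #containing (X n k)} lam (#containing-homogeneous (∣X∣ k))) s≤k λ Z ∣Z∣≡s →
      trans (cong (α *_) (balanced Z ∣Z∣≡s)) (trans (*-comm α lam)
        (cong (lam *_) (sym (trans (#containing-X k Z) (cong (aboveCount n k) ∣Z∣≡s)))))
    agree-∅ : α * length ℬ ≡ lam * length (X n k)
    agree-∅ = trans (cong (α *_) (sym (#containing-∅ ℬ ⊥ (∣⊥∣≡0 n))))
      (trans (agree ⊥ (≤-trans (≤-reflexive (∣⊥∣≡0 n)) z≤n)) (cong (lam *_) (#containing-∅ (X n k) ⊥ (∣⊥∣≡0 n))))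

module Weighted {c ℓ₁ ℓ₂ ℓ₃} (F : OrderedField c ℓ₁ ℓ₂ ℓ₃) where

  open Counting
  open ℕSum using (sum)
  open OrderedField F hiding (zero)
  open import Algebra.Properties.CommutativeSemigroup
    (CommutativeRing.*-commutativeSemigroup commutativeRing) using (x∙yz≈y∙xz)
  open import Algebra.Properties.CommutativeSemigroup
    (CommutativeRing.+-commutativeSemigroup commutativeRing) using () renaming (x∙yz≈y∙xz to x+[y+z]≈y+[x+z])
  open import Algebra.Properties.Monoid.Sum *-monoid using ()
    renaming (sum-init-last to ∏-init-last; sum-cong-≗ to ∏-cong-≗)
  open import Algebra.Properties.Ring (CommutativeRing.ring commutativeRing)
    using (-0#≈0#; +-cancelˡ; +-cancelʳ)
  open import Algebra.Properties.Semiring.Mult semiring using (×-homo-+; ×1-homo-*)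
  open import Algebra.Properties.Semiring.Sum semiring using ()
    renaming (sum-cong-≋ to ∑-cong; *-distribˡ-sum to *-distribˡ-∑; ∑-distrib-+ to ∑-+)
  open import Relation.Binary.Reasoning.Setoid (CommutativeRing.setoid commutativeRing)

  private
    variable
      n : ℕ

  -- Cancellation and natural numbers in the ordered field.

  *-cancelˡ-pos : ∀ {a x y} → 0# < a → a * x ≈ a * y → x ≈ y
  *-cancelˡ-pos {a} {x} {y} 0<a ax≈ay
    with a⁻¹ , inverseˡ , _ ← #⇒invertible (#-sym (<⇒# 0<a)) = begin
    x                      ≈⟨ *-identityˡ x ⟨
    1# * x                 ≈⟨ *-congʳ a⁻¹a≈1 ⟨
    (a⁻¹ * a) * x          ≈⟨ *-assoc a⁻¹ a x ⟩
    a⁻¹ * (a * x)          ≈⟨ *-congˡ ax≈ay ⟩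
    a⁻¹ * (a * y)          ≈⟨ *-assoc a⁻¹ a y ⟨
    (a⁻¹ * a) * y          ≈⟨ *-congʳ a⁻¹a≈1 ⟩
    1# * y                 ≈⟨ *-identityˡ y ⟩
    y                      ∎
    where
    -- Apartness from zero yields an inverse of the difference `a - 0#`, which is then identified
    -- with `a`.
    a⁻¹a≈1 : a⁻¹ * a ≈ 1#
    a⁻¹a≈1 = trans (*-congˡ (sym (trans (+-congˡ -0#≈0#) (+-identityʳ a)))) inverseˡ

  ι-cong : ∀ {k l} → k ≡ l → ι k ≈ ι l
  ι-cong ≡.refl = refl

  ι-mono-< : ∀ {k l} → k ℕ.< l → ι k < ι l
  ι-mono-< {k} k<l with d , ≡.refl ← ℕ.m≤n⇒∃[o]m+o≡n k<l =
    <-respˡ-≈ (+-identityʳ (ι k))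
      (<-respʳ-≈ (trans (sym (×-homo-+ 1# k (suc d))) (ι-cong (ℕ.+-suc k d)))
        (+-monoʳ-< (ι k) (0<ι d)))

  -- Characteristic zero follows from the order; the trichotomy is that of `ℕ`, since the order of
  -- the field need not be decidable. This brings equations between weighted counts back to the
  -- counts.
  ι-injective : ∀ {k l} → ι k ≈ ι l → k ≡ l
  ι-injective {k} {l} eq with ℕ.<-cmp k l
  ... | tri< k<l _ _ = contradiction (ι-mono-< k<l) (<-irrefl eq)
  ... | tri≈ _ k≡l _ = k≡l
  ... | tri> _ _ l<k = contradiction (ι-mono-< l<k) (<-irrefl (sym eq))

  0<ι′ : ∀ {k} → 0 ℕ.< k → 0# < ι k
  0<ι′ {suc k} _ = 0<ι k

  /-*-cancel : ∀ x {k} → 0 ℕ.< k → x / k * ι k ≈ x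
  /-*-cancel x {suc k} _ = trans (*-assoc x _ _) (trans (*-congˡ inverse) (*-identityʳ x))
    where
    inverse : ι⁻¹[1+ k ] * ι (suc k) ≈ 1#
    inverse = trans (*-congˡ (sym (trans (+-congˡ -0#≈0#) (+-identityʳ _))))
                    (proj₁ (proj₂ (#⇒invertible (#-sym (<⇒# (0<ι k))))))

  ι-∑ : (g : Fin n → ℕ) → ι (sum g) ≈ ∑ (λ p → ι (g p))
  ι-∑ {zero}  g = refl
  ι-∑ {suc n} g = trans (×-homo-+ 1# (g zero) _) (+-congˡ (ι-∑ (g ∘ suc)))

  ∑₂ : (g : Fin 2 → Carrier) → ∑ g ≈ g 0F + g 1F
  ∑₂ g = +-congˡ (+-identityʳ _)

  -- The product formula for counts in a shell.

  ∏-ratio : ℕ → ℕ → ℕ → Carrier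
  ∏-ratio n r m = ∏ (λ (j : Fin m) → ι (r ∸ toℕ j) / (n ∸ toℕ j))

  ∏-ratio-suc : ∀ n r m → ∏-ratio n r (suc m) ≈ ∏-ratio n r m * (ι (r ∸ m) / (n ∸ m))
  ∏-ratio-suc n r m = trans (∏-init-last {m} (term ∘ toℕ)) (reflexive (≡.cong₂ _*_
    (∏-cong-≗ (λ (j : Fin m) → ≡.cong term (toℕ-inject₁ j))) (≡.cong term (toℕ-fromℕ m))))
    where
    term : ℕ → Carrier
    term j = ι (r ∸ j) / (n ∸ j)

  -- By `aboveCount-ratio`, passing from size `m` to `m + 1` multiplies the count by
  -- `(r - m) / (n - m)`. The bound `m ≤ suc r` admits the case `t = r + 1`, where the last
  -- numerator is zero and both sides vanish. The product index stays at most `r`, so no numerator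
  -- is truncated.
  aboveCount-∏ : ∀ {n r} m → m ≤ n → m ≤ suc r →
                 ι (aboveCount n r m) ≈ ι (length (X n r)) * ∏-ratio n r m
  aboveCount-∏ zero _ _ = sym (*-identityʳ _)
  aboveCount-∏ {n} {r} (suc m) m<n (ℕ.s≤s m≤r) = *-cancelˡ-pos (0<ι′ 0<n∸m) (begin
    ι (n ∸ m) * ι (aboveCount n r (suc m))                       ≈⟨ ×1-homo-* (n ∸ m) _ ⟨
    ι ((n ∸ m) ℕ.* aboveCount n r (suc m))                       ≈⟨ ι-cong (aboveCount-ratio (ℕ.<⇒≤ m<n) m≤r) ⟩
    ι ((r ∸ m) ℕ.* aboveCount n r m)                             ≈⟨ ×1-homo-* (r ∸ m) _ ⟩
    ι (r ∸ m) * ι (aboveCount n r m)                             ≈⟨ *-comm _ _ ⟩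
    ι (aboveCount n r m) * ι (r ∸ m)                             ≈⟨ *-cong (aboveCount-∏ m (ℕ.<⇒≤ m<n) (ℕ.m≤n⇒m≤1+n m≤r))
                                                                     (sym (/-*-cancel _ 0<n∸m)) ⟩
    (ι (length (X n r)) * ∏-ratio n r m) * (q * ι (n ∸ m))       ≈⟨ *-assoc _ q _ ⟨
    (ι (length (X n r)) * ∏-ratio n r m) * q * ι (n ∸ m)         ≈⟨ *-comm _ _ ⟩
    ι (n ∸ m) * ((ι (length (X n r)) * ∏-ratio n r m) * q)       ≈⟨ *-congˡ (*-assoc _ _ q) ⟩
    ι (n ∸ m) * (ι (length (X n r)) * (∏-ratio n r m * q))       ≈⟨ *-congˡ (*-congˡ (∏-ratio-suc n r m)) ⟨
    ι (n ∸ m) * (ι (length (X n r)) * ∏-ratio n r (suc m))       ∎)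
    where
    q = ι (r ∸ m) / (n ∸ m)
    0<n∸m : 0 ℕ.< n ∸ m
    0<n∸m = ℕ.m<n⇒0<n∸m m<n

  -- Separating the contributions of the two shells.

  homogeneous-∑ : ∀ {k} {G : Subset n → ℕ} → Homogeneous k G → ∀ a Z →
                  ∑ (λ p → a * ι (G (⁅ p ⁆ ∪ Z))) ≈ ι k * (a * ι (G Z))
  homogeneous-∑ {n} {k} {G} hom a Z = begin
    ∑ (λ p → a * ι (G (⁅ p ⁆ ∪ Z)))    ≈⟨ *-distribˡ-∑ {n} a _ ⟨
    a * ∑ (λ p → ι (G (⁅ p ⁆ ∪ Z)))    ≈⟨ *-congˡ (ι-∑ {n} _) ⟨
    a * ι (sum (λ p → G (⁅ p ⁆ ∪ Z)))  ≈⟨ *-congˡ (ι-cong (hom Z)) ⟩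
    a * ι (k ℕ.* G Z)                  ≈⟨ *-congˡ (×1-homo-* k (G Z)) ⟩
    a * (ι k * ι (G Z))                ≈⟨ x∙yz≈y∙xz a _ _ ⟩
    ι k * (a * ι (G Z))                ∎

  -- The second equation minus `l` times the first leaves `(k - l) x₀ = (k - l) y₀`. With
  -- `k = suc (l + d)` the factor is `suc d`, whose image in the field is positive and cancels.
  linear-separation-< : ∀ {k l x₀ x₁ y₀ y₁} → l ℕ.< k → x₀ + x₁ ≈ y₀ + y₁ →
                        ι k * x₀ + ι l * x₁ ≈ ι k * y₀ + ι l * y₁ → x₀ ≈ y₀
  linear-separation-< {k} {l} {x₀} {x₁} {y₀} {y₁} l<k eq eq′
    with d , ≡.refl ← ℕ.m≤n⇒∃[o]m+o≡n l<k =
    *-cancelˡ-pos (0<ι d) (+-cancelˡ (ι l * (x₀ + x₁)) _ _ (begin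
      ι l * (x₀ + x₁) + ι (suc d) * x₀         ≈⟨ regroup x₀ x₁ ⟨
      ι (suc l ℕ.+ d) * x₀ + ι l * x₁          ≈⟨ eq′ ⟩
      ι (suc l ℕ.+ d) * y₀ + ι l * y₁          ≈⟨ regroup y₀ y₁ ⟩
      ι l * (y₀ + y₁) + ι (suc d) * y₀         ≈⟨ +-congʳ (*-congˡ eq) ⟨
      ι l * (x₀ + x₁) + ι (suc d) * y₀         ∎))
    where
    regroup : ∀ u v → ι (suc l ℕ.+ d) * u + ι l * v ≈ ι l * (u + v) + ι (suc d) * u
    regroup u v = begin
      ι (suc l ℕ.+ d) * u + ι l * v               ≈⟨ +-congʳ (*-congʳ (trans (ι-cong (≡.sym (ℕ.+-suc l d)))
                                                       (×-homo-+ 1# l (suc d)))) ⟩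
      (ι l + ι (suc d)) * u + ι l * v             ≈⟨ +-congʳ (distribʳ u _ _) ⟩
      (ι l * u + ι (suc d) * u) + ι l * v         ≈⟨ +-assoc _ _ _ ⟩
      ι l * u + (ι (suc d) * u + ι l * v)         ≈⟨ +-congˡ (+-comm _ _) ⟩
      ι l * u + (ι l * v + ι (suc d) * u)         ≈⟨ +-assoc _ _ _ ⟨
      (ι l * u + ι l * v) + ι (suc d) * u         ≈⟨ +-congʳ (distribˡ _ u v) ⟨
      ι l * (u + v) + ι (suc d) * u               ∎

  -- A two by two system with determinant `l - k`. The unknown with the larger multiplier is
  -- recovered first; the other follows from the plain sum.
  linear-separation : ∀ {k l x₀ x₁ y₀ y₁} → k ≢ l → x₀ + x₁ ≈ y₀ + y₁ →
                      ι k * x₀ + ι l * x₁ ≈ ι k * y₀ + ι l * y₁ → x₀ ≈ y₀ × x₁ ≈ y₁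
  linear-separation {k} {l} {x₀} {x₁} {y₀} {y₁} k≢l eq eq′ with ℕ.<-cmp k l
  ... | tri≈ _ k≡l _ = contradiction k≡l k≢l
  ... | tri> _ _ l<k = x₀≈y₀ , +-cancelˡ y₀ x₁ y₁ (trans (+-congʳ (sym x₀≈y₀)) eq)
    where
    x₀≈y₀ = linear-separation-< l<k eq eq′
  ... | tri< k<l _ _ = +-cancelʳ y₁ x₀ y₀ (trans (+-congˡ (sym x₁≈y₁)) eq) , x₁≈y₁
    where
    swap : ∀ {u v u′ v′} → u + v ≈ u′ + v′ → v + u ≈ v′ + u′
    swap eq = trans (+-comm _ _) (trans eq (+-comm _ _))
    x₁≈y₁ = linear-separation-< k<l (swap eq) (swap eq′)

  -- Summing the hypothesis over the sets ⁅ p ⁆ ∪ Z multiplies the ν-th term by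
  -- r ν, which gives a second, independent equation for the two terms.
  homogeneous-separation :
    ∀ {r : Fin 2 → ℕ} {G H : Fin 2 → Subset n → ℕ} {t} (a b : Fin 2 → Carrier) →
    r 0F ≢ r 1F → (∀ ν → Homogeneous (r ν) (G ν)) → (∀ ν → Homogeneous (r ν) (H ν)) →
    (∀ Z → ∣ Z ∣ ≤ t → ∑ (λ ν → a ν * ι (G ν Z)) ≈ ∑ (λ ν → b ν * ι (H ν Z))) →
    ∀ Z → ∣ Z ∣ ℕ.< t → ∀ ν → a ν * ι (G ν Z) ≈ b ν * ι (H ν Z)
  homogeneous-separation {n} {r} {G} {H} a b r₀≢r₁ homG homH eq Z ∣Z∣<t = λ
    { 0F → proj₁ separated ; 1F → proj₂ separated }
    where
    expand : (d : Fin 2 → Carrier) (K : Fin 2 → Subset n → ℕ) → (∀ ν → Homogeneous (r ν) (K ν)) →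
             ∑ (λ p → ∑ (λ ν → d ν * ι (K ν (⁅ p ⁆ ∪ Z)))) ≈
             ι (r 0F) * (d 0F * ι (K 0F Z)) + ι (r 1F) * (d 1F * ι (K 1F Z))
    expand d K hom = begin
      ∑ (λ p → ∑ (λ ν → d ν * ι (K ν (⁅ p ⁆ ∪ Z))))
        ≈⟨ ∑-cong {n} (λ p → ∑₂ (λ ν → d ν * ι (K ν (⁅ p ⁆ ∪ Z)))) ⟩
      ∑ (λ p → d 0F * ι (K 0F (⁅ p ⁆ ∪ Z)) + d 1F * ι (K 1F (⁅ p ⁆ ∪ Z)))
        ≈⟨ ∑-+ {n} _ _ ⟩
      ∑ (λ p → d 0F * ι (K 0F (⁅ p ⁆ ∪ Z))) + ∑ (λ p → d 1F * ι (K 1F (⁅ p ⁆ ∪ Z)))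
        ≈⟨ +-cong (homogeneous-∑ {k = r 0F} {K 0F} (hom 0F) (d 0F) Z) (homogeneous-∑ {k = r 1F} {K 1F} (hom 1F) (d 1F) Z) ⟩
      ι (r 0F) * (d 0F * ι (K 0F Z)) + ι (r 1F) * (d 1F * ι (K 1F Z)) ∎
    separated = linear-separation r₀≢r₁
      (trans (sym (∑₂ (λ ν → a ν * ι (G ν Z))))
        (trans (eq Z (ℕ.<⇒≤ ∣Z∣<t)) (∑₂ (λ ν → b ν * ι (H ν Z)))))
      -- Summing over `p` uses the hypothesis at sizes up to `suc ∣ Z ∣`, which is why the bound on
      -- `∣ Z ∣` is strict.
      (trans (sym (expand a G homG))
        (trans (∑-cong {n} (λ p → eq (⁅ p ⁆ ∪ Z) (ℕ.≤-trans (∣⁅p⁆∪Z∣≤ p Z) ∣Z∣<t)))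
               (expand b H homH)))

  -- Weighted sums over lists of points.

  ∑ₗ-cong : ∀ {a} {A : Set a} (xs : List A) {g h : A → Carrier} →
            (∀ {x} → x ∈ xs → g x ≈ h x) → ∑ₗ xs g ≈ ∑ₗ xs h
  ∑ₗ-cong []       eq = refl
  ∑ₗ-cong (x ∷ xs) eq = +-cong (eq (here ≡.refl)) (∑ₗ-cong xs (eq ∘ there))

  ∑ₗ-const : ∀ {a} {A : Set a} (xs : List A) u → ∑ₗ xs (λ _ → u) ≈ ι (length xs) * u
  ∑ₗ-const []       u = sym (zeroˡ u)
  ∑ₗ-const (x ∷ xs) u = trans (+-cong (sym (*-identityˡ u)) (∑ₗ-const xs u)) (sym (distribʳ u 1# _))

  *-distribˡ-∑ₗ : ∀ {a} {A : Set a} (xs : List A) u (g : A → Carrier) →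
                  ∑ₗ xs (λ x → u * g x) ≈ u * ∑ₗ xs g
  *-distribˡ-∑ₗ []       u g = sym (zeroʳ u)
  *-distribˡ-∑ₗ (x ∷ xs) u g = trans (+-congˡ (*-distribˡ-∑ₗ xs u g)) (sym (distribˡ u _ _))

  ∑ₗ-f : (xs : List (Point n)) (z : Point n) → ∑ₗ xs (f F z) ≈ ι (#containing xs z)
  ∑ₗ-f []       z = refl
  ∑ₗ-f (x ∷ xs) z with z ⊆? x
  ... | yes _ = +-congˡ (∑ₗ-f xs z)
  ... | no  _ = trans (+-identityˡ _) (∑ₗ-f xs z)

  ∑ₗ-∩X-accept : ∀ {r} y (Y : List (Point n)) (g : Point n → Carrier) → ∣ y ∣ ≡ r →
                 ∑ₗ ((y ∷ Y) ∩X r) g ≈ g y + ∑ₗ (Y ∩X r) g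
  ∑ₗ-∩X-accept {r = r} y Y g eq =
    reflexive (≡.cong (λ xs → ∑ₗ xs g) (filter-accept (λ x → ∣ x ∣ ℕ.≟ r) {x = y} {Y} eq))

  ∑ₗ-∩X-reject : ∀ {r} y (Y : List (Point n)) (g : Point n → Carrier) → ∣ y ∣ ≢ r →
                 ∑ₗ ((y ∷ Y) ∩X r) g ≈ ∑ₗ (Y ∩X r) g
  ∑ₗ-∩X-reject {r = r} y Y g neq =
    reflexive (≡.cong (λ xs → ∑ₗ xs g) (filter-reject (λ x → ∣ x ∣ ℕ.≟ r) {x = y} {Y} neq))

  -- Each entry has one of the two radii and, these being distinct, passes exactly one of the two
  -- filters.
  ∑ₗ-shells : (r : Fin 2 → ℕ) → r 0F ≢ r 1F → (Y : List (Point n)) →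
              (∀ {y} → y ∈ Y → ∃ λ ν → ∣ y ∣ ≡ r ν) → (g : Point n → Carrier) →
              ∑ₗ Y g ≈ ∑ₗ (Y ∩X r 0F) g + ∑ₗ (Y ∩X r 1F) g
  ∑ₗ-shells r r₀≢r₁ []      Y⊆X g = sym (+-identityˡ _)
  ∑ₗ-shells r r₀≢r₁ (y ∷ Y) Y⊆X g with Y⊆X (here ≡.refl)
  ... | 0F , eq = begin
    g y + ∑ₗ Y g                                        ≈⟨ +-congˡ (∑ₗ-shells r r₀≢r₁ Y (Y⊆X ∘ there) g) ⟩
    g y + (∑ₗ (Y ∩X r 0F) g + ∑ₗ (Y ∩X r 1F) g)         ≈⟨ +-assoc _ _ _ ⟨
    g y + ∑ₗ (Y ∩X r 0F) g + ∑ₗ (Y ∩X r 1F) g           ≈⟨ +-cong (∑ₗ-∩X-accept y Y g eq)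
                                                             (∑ₗ-∩X-reject y Y g (λ eq′ → r₀≢r₁ (≡.trans (≡.sym eq) eq′))) ⟨
    ∑ₗ ((y ∷ Y) ∩X r 0F) g + ∑ₗ ((y ∷ Y) ∩X r 1F) g     ∎
  ... | 1F , eq = begin
    g y + ∑ₗ Y g                                        ≈⟨ +-congˡ (∑ₗ-shells r r₀≢r₁ Y (Y⊆X ∘ there) g) ⟩
    g y + (∑ₗ (Y ∩X r 0F) g + ∑ₗ (Y ∩X r 1F) g)         ≈⟨ x+[y+z]≈y+[x+z] _ _ _ ⟩
    ∑ₗ (Y ∩X r 0F) g + (g y + ∑ₗ (Y ∩X r 1F) g)         ≈⟨ +-cong (∑ₗ-∩X-reject y Y g (λ eq′ → r₀≢r₁ (≡.trans (≡.sym eq′) eq)))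
                                                             (∑ₗ-∩X-accept y Y g eq) ⟨
    ∑ₗ ((y ∷ Y) ∩X r 0F) g + ∑ₗ ((y ∷ Y) ∩X r 1F) g     ∎

  -- The classical formula for the number of blocks through a small set. Proportionality to the full
  -- shell reduces it to `aboveCount-∏`; the shell size that cancels is positive because `k ≤ n`.
  design-∏ : ∀ {s n k lam} {ℬ : List (Subset n)} → IsDesign s n k lam ℬ → s ≤ k → k ≤ n →
             ∀ Z → ∣ Z ∣ ≤ s → ι (#containing ℬ Z) ≈ ι (length ℬ) * ∏-ratio n k ∣ Z ∣
  design-∏ {n = n} {k} {ℬ = ℬ} D s≤k k≤n Z ∣Z∣≤s = *-cancelˡ-pos (0<ι′ (aboveCount-pos {n} {k} {0} ℕ.z≤n k≤n)) (begin
    ι (length (X n k)) * ι (#containing ℬ Z)                          ≈⟨ ×1-homo-* (length (X n k)) _ ⟨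
    ι (length (X n k) ℕ.* #containing ℬ Z)                            ≈⟨ ι-cong (ℕ.*-comm (length (X n k)) _) ⟩
    ι (#containing ℬ Z ℕ.* length (X n k))                            ≈⟨ ι-cong (design-proportion D s≤k k≤n Z ∣Z∣≤s) ⟩
    ι (length ℬ ℕ.* #containing (X n k) Z)                            ≈⟨ ×1-homo-* (length ℬ) _ ⟩
    ι (length ℬ) * ι (#containing (X n k) Z)                          ≈⟨ *-congˡ (ι-cong (#containing-X k Z)) ⟩
    ι (length ℬ) * ι (aboveCount n k ∣ Z ∣)                           ≈⟨ *-congˡ (aboveCount-∏ ∣ Z ∣ (∣p∣≤n Z)
                                                                          (ℕ.≤-trans ∣Z∣≤s (ℕ.m≤n⇒m≤1+n s≤k))) ⟩
    ι (length ℬ) * (ι (length (X n k)) * ∏-ratio n k ∣ Z ∣)           ≈⟨ x∙yz≈y∙xz _ _ _ ⟩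
    ι (length (X n k)) * (ι (length ℬ) * ∏-ratio n k ∣ Z ∣)           ∎)

  -- Two shells with constant weight on each.

  module TwoShells
    {n t : ℕ} (1≤t : 1 ≤ t)
    {r : Fin 2 → ℕ} (r-injective : Injective _≡_ _≡_ r)
    (r≤n : ∀ ν → r ν ≤ n) (t∸1≤r : ∀ ν → t ∸ 1 ≤ r ν)
    (Yw : PositiveWeightedSubset F n)
    (Y⊆X : ∀ {y} → y ∈ PositiveWeightedSubset.Y Yw → ∃ λ ν → ∣ B y ∣ ≡ r ν)
    {wᵣ : Fin 2 → Carrier}
    (w≈wᵣ : ∀ ν {y} → y ∈ PositiveWeightedSubset.Y Yw ∩X r ν → PositiveWeightedSubset.w Yw y ≈ wᵣ ν)
    where

    open PositiveWeightedSubset Yw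

    ℬ : Fin 2 → List (Subset n)
    ℬ ν = blocks (Y ∩X r ν)

    N : Fin 2 → ℕ
    N ν = length (Y ∩X r ν)

    shellCoefficient : Fin 2 → Carrier
    shellCoefficient ν = ∑ₗ (Y ∩X r ν) w / length (X n (r ν))

    -- The right and left sides, in this order, of the relative design condition, with sums of `f`
    -- replaced by counts. Both make sense for empty `Z`, a size that the condition itself leaves
    -- out.
    blockSum shellSum : Subset n → Carrier
    blockSum Z = ∑ (λ ν → wᵣ ν * ι (#containing (ℬ ν) Z))
    shellSum Z = ∑ (λ ν → shellCoefficient ν * ι (#containing (X n (r ν)) Z))

    ratioSum : ℕ → Carrier
    ratioSum m = ∑ (λ ν → ι (N ν) * wᵣ ν * ∏-ratio n (r ν) m)

    r₀≢r₁ : r 0F ≢ r 1F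
    r₀≢r₁ eq with () ← r-injective eq

    t≤1+r : ∀ ν → t ≤ suc (r ν)
    t≤1+r ν = ℕ.≤-trans (ℕ.m≤n+m∸n t 1) (ℕ.s≤s (t∸1≤r ν))

    t∸1<t : t ∸ 1 ℕ.< t
    t∸1<t = ℕ.≤-reflexive (ℕ.m+[n∸m]≡n 1≤t)

    ℬ≡ : ∀ ν → ℬ ν ≡ Y ∩X r ν
    ℬ≡ ν = map-id (Y ∩X r ν)

    ∣ℬ∣ : ∀ ν → All (λ b → ∣ b ∣ ≡ r ν) (ℬ ν)
    ∣ℬ∣ ν = ≡.subst (All _) (≡.sym (ℬ≡ ν)) (all-filter (λ x → ∣ x ∣ ℕ.≟ r ν) Y)

    relativeDesign-lhs : ∀ z → ∑ (λ ν → shellCoefficient ν * ∑ₗ (X n (r ν)) (f F z)) ≈ shellSum z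
    relativeDesign-lhs z = ∑-cong {2} (λ ν → *-congˡ {shellCoefficient ν} (∑ₗ-f (X n (r ν)) z))

    relativeDesign-rhs : ∀ z → ∑ₗ Y (λ y → w y * f F z y) ≈ blockSum z
    relativeDesign-rhs z = begin
      ∑ₗ Y g                                   ≈⟨ ∑ₗ-shells r r₀≢r₁ Y Y⊆X g ⟩
      ∑ₗ (Y ∩X r 0F) g + ∑ₗ (Y ∩X r 1F) g      ≈⟨ +-cong (shell 0F) (shell 1F) ⟩
      wᵣ 0F * ι (#containing (ℬ 0F) z) + wᵣ 1F * ι (#containing (ℬ 1F) z)
                                               ≈⟨ ∑₂ (λ ν → wᵣ ν * ι (#containing (ℬ ν) z)) ⟨
      blockSum z                               ∎
      where
      g : Point n → Carrier
      g y = w y * f F z y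
      shell : ∀ ν → ∑ₗ (Y ∩X r ν) g ≈ wᵣ ν * ι (#containing (ℬ ν) z)
      shell ν = begin
        ∑ₗ (Y ∩X r ν) g                            ≈⟨ ∑ₗ-cong (Y ∩X r ν) (*-congʳ ∘ w≈wᵣ ν) ⟩
        ∑ₗ (Y ∩X r ν) (λ y → wᵣ ν * f F z y)       ≈⟨ *-distribˡ-∑ₗ (Y ∩X r ν) (wᵣ ν) (f F z) ⟩
        wᵣ ν * ∑ₗ (Y ∩X r ν) (f F z)               ≈⟨ *-congˡ (∑ₗ-f (Y ∩X r ν) z) ⟩
        wᵣ ν * ι (#containing (Y ∩X r ν) z)        ≡⟨ ≡.cong (λ b → wᵣ ν * ι (#containing b z)) (ℬ≡ ν) ⟨
        wᵣ ν * ι (#containing (ℬ ν) z)             ∎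

    -- The shell size in the product formula cancels the denominator of `shellCoefficient`, and
    -- constancy of the weight turns the remaining total weight into `ι (N ν) * wᵣ ν`.
    shellTerm : ∀ Z → ∣ Z ∣ ≤ t → ∀ ν → shellCoefficient ν * ι (#containing (X n (r ν)) Z) ≈
                                        ι (N ν) * wᵣ ν * ∏-ratio n (r ν) ∣ Z ∣
    shellTerm Z ∣Z∣≤t ν = begin
      shellCoefficient ν * ι (#containing (X n (r ν)) Z)
        ≈⟨ *-congˡ (trans (ι-cong (#containing-X (r ν) Z))
                          (aboveCount-∏ ∣ Z ∣ (∣p∣≤n Z) (ℕ.≤-trans ∣Z∣≤t (t≤1+r ν)))) ⟩
      shellCoefficient ν * (ι (length (X n (r ν))) * ∏-ratio n (r ν) ∣ Z ∣)
        ≈⟨ *-assoc _ _ _ ⟨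
      shellCoefficient ν * ι (length (X n (r ν))) * ∏-ratio n (r ν) ∣ Z ∣
        ≈⟨ *-congʳ (/-*-cancel _ (aboveCount-pos {n} {r ν} {0} ℕ.z≤n (r≤n ν))) ⟩
      ∑ₗ (Y ∩X r ν) w * ∏-ratio n (r ν) ∣ Z ∣
        ≈⟨ *-congʳ (trans (∑ₗ-cong (Y ∩X r ν) (w≈wᵣ ν)) (∑ₗ-const (Y ∩X r ν) (wᵣ ν))) ⟩
      ι (N ν) * wᵣ ν * ∏-ratio n (r ν) ∣ Z ∣ ∎

    shellSum≈ratioSum : ∀ Z → ∣ Z ∣ ≤ t → shellSum Z ≈ ratioSum ∣ Z ∣
    shellSum≈ratioSum Z ∣Z∣≤t = ∑-cong {2} (shellTerm Z ∣Z∣≤t)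

    -- The relative design condition starts at size one. At size zero both sides are the total
    -- weight of `Y`, so equality holds anyway; the separation at size `t - 1` uses it when `t = 1`.
    blockSum-∅ : ∀ Z → ∣ Z ∣ ≡ 0 → blockSum Z ≈ ratioSum 0
    blockSum-∅ Z ∣Z∣≡0 = ∑-cong {2} λ ν → begin
      wᵣ ν * ι (#containing (ℬ ν) Z)       ≈⟨ *-congˡ (ι-cong (≡.trans (#containing-∅ (ℬ ν) Z ∣Z∣≡0)
                                                (length-map B (Y ∩X r ν)))) ⟩
      wᵣ ν * ι (N ν)                       ≈⟨ *-comm _ _ ⟩
      ι (N ν) * wᵣ ν                       ≈⟨ *-identityʳ _ ⟨
      ι (N ν) * wᵣ ν * 1#                  ∎

    -- From a relative design to block designs.

    relativeDesign⇒blockSum : IsRelativeDesign F t r Yw → ∀ Z → ∣ Z ∣ ≤ t → blockSum Z ≈ shellSum Z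
    relativeDesign⇒blockSum D Z ∣Z∣≤t with ∣ Z ∣ in eq
    ... | zero  = trans (blockSum-∅ Z eq)
                    (trans (reflexive (≡.cong ratioSum (≡.sym eq)))
                      (sym (shellSum≈ratioSum Z (ℕ.≤-trans (ℕ.≤-reflexive eq) ∣Z∣≤t))))
    ... | suc j = trans (sym (relativeDesign-rhs Z)) (trans (sym (D (suc j) (ℕ.s≤s ℕ.z≤n) ∣Z∣≤t Z
                    (∈-filter⁺ (λ x → ∣ x ∣ ℕ.≟ suc j) (∈-points Z) eq))) (relativeDesign-lhs Z))

    relativeDesign⇒design : IsRelativeDesign F t r Yw → ∀ ν → ∃ λ lam → IsDesign (t ∸ 1) n (r ν) lam (ℬ ν)
    relativeDesign⇒design D ν
      with Z₀ , ∣Z₀∣ ← subsetOfSize (ℕ.≤-trans (t∸1≤r ν) (r≤n ν)) =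
      -- The index `lam` is read off at an arbitrary set of size `t - 1`, which exists because
      -- `t - 1 ≤ r ν ≤ n`.
      #containing (ℬ ν) Z₀ , record
        { unique    = ≡.subst Unique (≡.sym (ℬ≡ ν)) (Unique.filter⁺ (λ x → ∣ x ∣ ℕ.≟ r ν) unique)
        ; blockSize = ∣ℬ∣ ν
        ; balanced  = λ Z ∣Z∣ → constant Z Z₀ ∣Z∣ ∣Z₀∣
        }
      where
      -- The value that the full shell forces at size `t - 1`, free of `Z`.
      u : Carrier
      u = shellCoefficient ν * ι (aboveCount n (r ν) (t ∸ 1))
      separated : ∀ Z → ∣ Z ∣ ≡ t ∸ 1 →
                  wᵣ ν * ι (#containing (ℬ ν) Z) ≈ u
      separated Z ∣Z∣ = trans
        (homogeneous-separation {r = r} {G = #containing ∘ ℬ} {H = #containing ∘ X n ∘ r} wᵣ shellCoefficient r₀≢r₁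
          (λ ν → #containing-homogeneous (∣ℬ∣ ν)) (λ ν → #containing-homogeneous (∣X∣ (r ν)))
          (relativeDesign⇒blockSum D) Z (ℕ.≤-<-trans (ℕ.≤-reflexive ∣Z∣) t∸1<t) ν)
        (*-congˡ (ι-cong (≡.trans (#containing-X (r ν) Z) (≡.cong (aboveCount n (r ν)) ∣Z∣))))
      constant : ∀ Z Z′ → ∣ Z ∣ ≡ t ∸ 1 → ∣ Z′ ∣ ≡ t ∸ 1 → #containing (ℬ ν) Z ≡ #containing (ℬ ν) Z′
      constant Z Z′ ∣Z∣ ∣Z′∣ with Y ∩X r ν in eq
      -- An empty shell says nothing about the sign of `wᵣ ν`, but then all counts are zero.
      -- Otherwise a member `y` shows that `wᵣ ν` is positive, so it cancels.
      ... | []    = ≡.refl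
      ... | y ∷ _ = ι-injective (*-cancelˡ-pos 0<wᵣ (trans (sep Z ∣Z∣) (sym (sep Z′ ∣Z′∣))))
        where
        sep = ≡.subst (λ ys → ∀ Z → ∣ Z ∣ ≡ t ∸ 1 → wᵣ ν * ι (#containing (blocks ys) Z) ≈ u) eq separated
        y∈ : y ∈ Y ∩X r ν
        y∈ = ≡.subst (y ∈_) (≡.sym eq) (here ≡.refl)
        0<wᵣ : 0# < wᵣ ν
        0<wᵣ = <-respʳ-≈ (w≈wᵣ ν y∈) (w-pos (proj₁ (∈-filter⁻ (λ x → ∣ x ∣ ℕ.≟ r ν) {xs = Y} y∈)))

    relativeDesign⇒pointSet : IsRelativeDesign F t r Yw →
                              ∀ (i : Fin t → Fin n) → Injective _≡_ _≡_ i → blockSum (pointSet i) ≈ ratioSum t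
    relativeDesign⇒pointSet D i inj =
      trans (relativeDesign⇒blockSum D (pointSet i) ∣i∣≤t)
        (trans (shellSum≈ratioSum (pointSet i) ∣i∣≤t) (reflexive (≡.cong ratioSum (∣pointSet∣ i inj))))
      where
      ∣i∣≤t : ∣ pointSet i ∣ ≤ t
      ∣i∣≤t = ℕ.≤-reflexive (∣pointSet∣ i inj)

    -- From block designs to a relative design.

    design⇒blockSum : (∀ ν → ∃ λ lam → IsDesign (t ∸ 1) n (r ν) lam (ℬ ν)) →
                      ∀ Z → ∣ Z ∣ ≤ t ∸ 1 → blockSum Z ≈ ratioSum ∣ Z ∣
    design⇒blockSum D Z ∣Z∣≤t∸1 = ∑-cong {2} λ ν → begin
      wᵣ ν * ι (#containing (ℬ ν) Z)                          ≈⟨ *-congˡ (design-∏ (proj₂ (D ν)) (t∸1≤r ν) (r≤n ν) Z ∣Z∣≤t∸1) ⟩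
      wᵣ ν * (ι (length (ℬ ν)) * ∏-ratio n (r ν) ∣ Z ∣)       ≈⟨ *-congˡ (*-congʳ (ι-cong (length-map B (Y ∩X r ν)))) ⟩
      wᵣ ν * (ι (N ν) * ∏-ratio n (r ν) ∣ Z ∣)                ≈⟨ *-assoc _ _ _ ⟨
      wᵣ ν * ι (N ν) * ∏-ratio n (r ν) ∣ Z ∣                  ≈⟨ *-congʳ (*-comm _ _) ⟩
      ι (N ν) * wᵣ ν * ∏-ratio n (r ν) ∣ Z ∣                  ∎

    pointSet⇒blockSum : (∀ (i : Fin t → Fin n) → Injective _≡_ _≡_ i → blockSum (pointSet i) ≈ ratioSum t) →
                        ∀ Z → ∣ Z ∣ ≡ t → blockSum Z ≈ ratioSum ∣ Z ∣
    pointSet⇒blockSum eq Z ∣Z∣≡t with i , inj , i≡Z ← enumerate Z =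
      trans (reflexive (≡.cong blockSum (≡.sym i≡Z))) (eq′ i inj)
      where
      -- The enumeration of `Z` has `∣ Z ∣` points, so the hypothesis on `t` points is transported
      -- along `∣Z∣≡t`.
      eq′ : ∀ (i : Fin ∣ Z ∣ → Fin n) → Injective _≡_ _≡_ i → blockSum (pointSet i) ≈ ratioSum ∣ Z ∣
      eq′ = ≡.subst (λ m → ∀ (i : Fin m → Fin n) → Injective _≡_ _≡_ i → blockSum (pointSet i) ≈ ratioSum m)
                    (≡.sym ∣Z∣≡t) eq

    -- Below size `t` the designs determine the block count of each shell; at size `t` only the
    -- weighted sum of the two counts is known, from the equality on distinct points, and that is
    -- all the condition asks.
    relativeDesign⇐ : (∀ ν → ∃ λ lam → IsDesign (t ∸ 1) n (r ν) lam (ℬ ν)) →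
                      (∀ (i : Fin t → Fin n) → Injective _≡_ _≡_ i → blockSum (pointSet i) ≈ ratioSum t) →
                      IsRelativeDesign F t r Yw
    relativeDesign⇐ D eq j 1≤j j≤t z z∈X = begin
      ∑ (λ ν → shellCoefficient ν * ∑ₗ (X n (r ν)) (f F z))  ≈⟨ relativeDesign-lhs z ⟩
      shellSum z                                             ≈⟨ shellSum≈ratioSum z (≡.subst (_≤ t) (≡.sym ∣z∣≡j) j≤t) ⟩
      ratioSum ∣ z ∣                                         ≈⟨ blockSum≈ratioSum (ℕ.m≤n⇒m<n∨m≡n j≤t) ⟨
      blockSum z                                             ≈⟨ relativeDesign-rhs z ⟨
      ∑ₗ Y (λ y → w y * f F z y)                             ∎
      where
      ∣z∣≡j : ∣ z ∣ ≡ j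
      ∣z∣≡j = proj₂ (∈-filter⁻ (λ x → ∣ x ∣ ℕ.≟ j) {xs = points n} z∈X)
      blockSum≈ratioSum : j ℕ.< t ⊎ j ≡ t → blockSum z ≈ ratioSum ∣ z ∣
      blockSum≈ratioSum (inj₁ j<t) = design⇒blockSum D z (≡.subst (_≤ t ∸ 1) (≡.sym ∣z∣≡j) (ℕ.∸-monoˡ-≤ 1 j<t))
      blockSum≈ratioSum (inj₂ j≡t) = pointSet⇒blockSum eq z (≡.trans ∣z∣≡j j≡t)

theorem3p4 :
  ∀ {c ℓ₁ ℓ₂ ℓ₃} (F : OrderedField c ℓ₁ ℓ₂ ℓ₃) →
  let open OrderedField F in
  (n t : ℕ) → 1 ≤ t →
  (r : Fin 2 → ℕ) → Injective _≡_ _≡_ r →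
  (∀ ν → r ν ≤ n) → (∀ ν → t ∸ 1 ≤ r ν) →
  (Yw : PositiveWeightedSubset F n) →
  let open PositiveWeightedSubset Yw in
  (∀ {y} → y ∈ Y → ∃ λ ν → ∣ B y ∣ ≡ r ν) →
  (wᵣ : Fin 2 → Carrier) →
  (∀ ν {y} → y ∈ Y ∩X r ν → w y ≈ wᵣ ν) →
  let ℬ = λ ν → blocks (Y ∩X r ν)
      N = λ ν → length (Y ∩X r ν)
  in
  IsRelativeDesign F t r Yw
    ⇔
  ((∀ ν → ∃ λ lam → IsDesign (t ∸ 1) n (r ν) lam (ℬ ν))
   ×
   (∀ (i : Fin t → Fin n) → Injective _≡_ _≡_ i →
      ∑ (λ ν → wᵣ ν * ι (#containing (ℬ ν) (pointSet i)))
        ≈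
      ∑ (λ ν → ι (N ν) * wᵣ ν * ∏ (λ (j : Fin t) → ι (r ν ∸ toℕ j) / (n ∸ toℕ j)))))
theorem3p4 F n t 1≤t r r-injective r≤n t∸1≤r Yw Y⊆X wᵣ w≈wᵣ =
  mk⇔ (λ D → relativeDesign⇒design D , relativeDesign⇒pointSet D)
      (λ (D , eq) → relativeDesign⇐ D eq)
  where
  open Weighted.TwoShells F 1≤t r-injective r≤n t∸1≤r Yw Y⊆X w≈wᵣ
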